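{- Let $n\geq 1$. For any $\mu,\mu'\in\mathsf{BP}_n$, we have $\mu\equiv_0\mu'$ if and only if for every automata network $f:X\to X$ of size $n$ (that is, for every choice of finite non-empty alphabets $X_0,\dots,X_{n-1}$, with $X=\prod_{i\in\llbracket n\rrbracket}X_i$, and every function $f:X\to X$), $f_{\{\mu\}}=f_{\{\mu'\}}$.
   Context: Notation: $\llbracket n\rrbracket=\{0,\dots,n-1\}$. A partitioned order of $\llbracket n\rrbracket$ is an (unordered) set $\{S_k\}_{k\in\llbracket s\rrbracket}$ of $s$ sequences $S_k=(i^k_0,\dots,i^k_{n_k-1})$ with $n_k>0$, each consisting of pairwise distinct elements of $\llbracket n\rrbracket$, the sequences being pairwise disjoint (as sets of entries) with union $\llbracket n\rrbracket$. $\mathsf{BP}_n$ is the set of all partitioned orders of $\llbracket n\rrbracket$ (block-parallel update modes of size $n$). For $\mu=\{S_k\}_{k\in\llbracket s\rrbracket}\in\mathsf{BP}_n$, let $p=\mathrm{lcm}(n_0,\dots,n_{s-1})$ and define the sequence of blocks $\varphi(\mu)=(W_\ell)_{\ell\in\llbracket p\rrbracket}$ by $W_\ell=\{i^k_{\ell \bmod n_k}\mid k\in\llbracket s\rrbracket\}$. For $\mu,\mu'\in\mathsf{BP}_n$, $\mu\equiv_0\mu'$ means $\varphi(\mu)=\varphi(\mu')$ (equality of sequences of sets). Automata networks: an automata network of size $n$ is a function $f:X\to X$ with $X=\prod_{i\in\llbracket n\rrbracket}X_i$, each $X_i$ being a finite alphabet; $f_i:X\to X_i$ is the $i$-th component of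 $f$. For $W\subseteq\llbracket n\rrbracket$, $f_{(W)}:X\to X$ is defined by $f_{(W)}(x)_i=f_i(x)$ if $i\in W$ and $f_{(W)}(x)_i=x_i$ otherwise. For $\mu\in\mathsf{BP}_n$ with $\varphi(\mu)=(W_0,\dots,W_{p-1})$, the update of $f$ under $\mu$ is $f_{\{\mu\}}=f_{(W_{p-1})}\circ\dots\circ f_{(W_1)}\circ f_{(W_0)}$. -}

module Defs where

open import Data.Bool.Base using (if_then_else_)
open import Data.Fin.Base using (Fin; zero; suc)
open import Data.Fin.Subset using (Subset; ⁅_⁆; ⋃)
open import Data.Fin.Subset.Properties using (_∈?_)
open import Data.List.Base using (List; applyUpTo; foldl; tabulate)
open import Data.Nat.Base using (ℕ; zero; suc; NonZero)
open import Data.Nat.DivMod using (_mod_)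
open import Data.Nat.LCM using (lcm)
open import Data.Product.Base using (_×_; _,_; ∃-syntax; ∃₂)
open import Data.Unit.Base using (⊤; tt)
import Data.Vec.Functional as Vector
open import Function.Base using (_∘_; id)
open import Function.Bundles using (_↔_)
open import Function.Definitions using (Injective)
open import Relation.Binary.PropositionalEquality.Core using (_≡_; _≢_)
open import Relation.Nullary.Decidable.Core using (does)

-- A partitioned order is an unordered set of sequences.  It is given here by
-- an enumeration seq 0, …, seq (s - 1) of that set (without repetition, as the
-- sequences are non-empty and disjoint).  Reindexing the sequences gives
-- another enumeration of the same partitioned order; `period` and `block`
-- below do not depend on this choice.
record BP (n : ℕ) : Set where
  field
    s            : ℕ
    size         : Fin s → ℕ
    size-nonZero : ∀ k → NonZero (size k)
    seq          : ∀ k → Fin (size k) → Fin n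
    distinct     : ∀ k → Injective _≡_ _≡_ (seq k)
    disjoint     : ∀ {k k′} → k ≢ k′ → ∀ j j′ → seq k j ≢ seq k′ j′
    covering     : ∀ i → ∃₂ λ k j → seq k j ≡ i

  period : ℕ
  period = Vector.foldr lcm 1 size

  block : ℕ → Subset n
  block ℓ = ⋃ (tabulate λ k → ⁅ seq k (_mod_ ℓ (size k) {{size-nonZero k}}) ⁆)

φ : ∀ {n} → BP n → List (Subset n)
φ μ = applyUpTo block period
  where open BP μ

infix 4 _≡₀_

_≡₀_ : ∀ {n} → BP n → BP n → Set
μ ≡₀ μ′ = φ μ ≡ φ μ′

IsAlphabet : Set → Set
IsAlphabet A = (∃[ m ] (A ↔ Fin m)) × A

-- The product ∏ᵢ X i as a type of tuples rather than of dependent functions: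
-- without function extensionality, _≡_ is too fine on the latter.
Config : ∀ {n} → (Fin n → Set) → Set
Config {zero}  X = ⊤
Config {suc n} X = X zero × Config (X ∘ suc)

component : ∀ {n} {X : Fin n → Set} → Config X → ∀ i → X i
component (a , x) zero    = a
component (a , x) (suc i) = component x i

config : ∀ {n} {X : Fin n → Set} → (∀ i → X i) → Config X
config {zero}  a = tt
config {suc n} a = a zero , config (a ∘ suc)

Network : ∀ {n} → (Fin n → Set) → Set
Network X = Config X → Config X

module _ {n} {X : Fin n → Set} where

  updateBlock : Network X → Subset n → Config X → Config X
  updateBlock f W x = config λ i →
    if does (i ∈? W) then component (f x) i else component x i

  -- The leftmost block of φ μ is applied first.
  update : Network X → BP n → Config X → Config X
  update f μ = foldl (λ g W → updateBlock f W ∘ g) id (φ μ)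

{-# OPTIONS --safe #-}
-- If φ μ = φ μ′ the updates agree trivially.  Conversely, some network lets the
-- final configuration reveal φ μ.  Every cell holds a list of blocks, initially
-- empty, and f gives each cell the list M ∷ h, where h is the longest list of
-- the configuration and M is the set of cells holding it.  Since blocks are not
-- empty, M is always the block updated last and h is the list of the blocks
-- before it, so M ∷ h is the reversed list of all blocks applied so far (on top
-- of the full set, for the initial configuration).  Only the finitely many lists
-- that occur during the two updates have to be letters of the alphabet.
module Submission where

open import Defs
open import Data.Bool.Base using (true; false; if_then_else_)
open import Data.Bool.Properties using () renaming (_≟_ to _≟ᴮ_)
open import Data.Fin.Base using (Fin; zero; suc)
open import Data.Fin.Subset using (Subset; ⊤; ⋃; Nonempty; _∈_; _∉_)
open import Data.Fin.Subset.Properties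
  using (_∈?_; ∈⊤; x∈⁅x⁆; x∈p∪q⁺)
open import Data.List.Base
  using (List; []; _∷_; [_]; _++_; _ʳ++_; foldl; length; lookup; tabulate)
open import Data.List.Membership.Propositional using () renaming (_∈_ to _∈ˡ_)
open import Data.List.Membership.Propositional.Properties
  using (∈-tabulate⁺; ∈-tabulate⁻)
import Data.List.Membership.DecPropositional as DecMembership
open import Data.List.Properties
  using (≡-dec; ʳ++-defn; ++-cancelʳ; reverse-injective)
open import Data.List.Relation.Binary.Subset.Propositional using (_⊆_)
open import Data.List.Relation.Binary.Subset.Propositional.Properties
  using (xs⊆xs++ys; xs⊆ys++xs)
open import Data.List.Relation.Unary.All as All using (All; []; _∷_)
open import Data.List.Relation.Unary.All.Properties using (applyUpTo⁺₂)
open import Data.List.Relation.Unary.Any using (here; there; index)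
open import Data.List.Relation.Unary.Any.Properties using (lookup-index)
open import Data.Nat.Base using (ℕ; suc; _≤_; _<_; _≥_)
open import Data.Nat.Properties
  using (≤-totalOrder; ≤-<-trans; <-irrefl; n<1+n; ≤⇒≯)
open import Data.List.Extrema ≤-totalOrder
  using (argmax; argmax-sel; f[xs]≤f[argmax])
open import Data.Product.Base using (_,_)
open import Data.Sum.Base using (inj₁; inj₂)
import Data.Vec.Base as Vec
import Data.Vec.Properties as Vecₚ
open import Function.Base using (_∘_; id)
open import Function.Bundles using (_⇔_; mk⇔)
open import Function.Construct.Identity using (↔-id)
open import Relation.Binary.Definitions using (DecidableEquality)
open import Relation.Binary.PropositionalEquality
  using (_≡_; _≗_; refl; sym; trans; cong; cong₂; subst)
open import Relation.Nullary using (does; yes; no; contradiction)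
open import Relation.Nullary.Decidable using (dec-true; dec-false)

ʳ++-injectiveˡ : ∀ {A : Set} {xs ys : List A} zs → xs ʳ++ zs ≡ ys ʳ++ zs → xs ≡ ys
ʳ++-injectiveˡ {xs = xs} {ys} zs eq =
  reverse-injective (++-cancelʳ zs _ _
    (trans (sym (ʳ++-defn xs)) (trans eq (ʳ++-defn ys))))

∈-⋃⁺ : ∀ {n} {p : Subset n} {ps i} → p ∈ˡ ps → i ∈ p → i ∈ ⋃ ps
∈-⋃⁺ (here refl)  i∈p = x∈p∪q⁺ (inj₁ i∈p)
∈-⋃⁺ (there p∈ps) i∈p = x∈p∪q⁺ (inj₂ (∈-⋃⁺ p∈ps i∈p))

block-nonempty : ∀ {n} (μ : BP (suc n)) ℓ → Nonempty (BP.block μ ℓ)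
-- The size is positive, so there is a cell `zero`; the sequence covering it contributes an entry to
-- every block.
block-nonempty μ ℓ with BP.covering μ zero
... | k , _ = _ , ∈-⋃⁺ (∈-tabulate⁺ k) (x∈⁅x⁆ _)

φ-nonempty : ∀ {n} (μ : BP (suc n)) → All Nonempty (φ μ)
φ-nonempty μ = applyUpTo⁺₂ (BP.block μ) (BP.period μ) (block-nonempty μ)

component-config : ∀ {n} {X : Fin n → Set} (a : ∀ i → X i) i →
                   component {X = X} (config a) i ≡ a i
component-config a zero    = refl
component-config a (suc i) = component-config (a ∘ suc) i

module _ {n} {X : Fin n → Set} (f : Network X) {W : Subset n} (x : Config X) {i : Fin n} where

  component-updateBlock :
    component (updateBlock f W x) i ≡
    (if does (i ∈? W) then component (f x) i else component x i)
  component-updateBlock = component-config {X = X}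
    (λ i → if does (i ∈? W) then component (f x) i else component x i) i

  updateBlock-∈ : i ∈ W → component (updateBlock f W x) i ≡ component (f x) i
  updateBlock-∈ i∈W = trans component-updateBlock
    (cong (if_then component (f x) i else component x i) (dec-true (i ∈? W) i∈W))

  updateBlock-∉ : i ∉ W → component (updateBlock f W x) i ≡ component x i
  updateBlock-∉ i∉W = trans component-updateBlock
    (cong (if_then component (f x) i else component x i) (dec-false (i ∈? W) i∉W))

-- A history lists blocks with the most recent one first.
History : ℕ → Set
History n = List (Subset n)

infix 4 _≟_

_≟_ : ∀ {n} → DecidableEquality (History n)
_≟_ = ≡-dec (Vecₚ.≡-dec _≟ᴮ_)

module _ {n} (c : Fin n → History n) where

  longest : History n
  longest = argmax length [] (tabulate c)

  length≤longest : ∀ i → length (c i) ≤ length longest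
  length≤longest i =
    All.lookup (f[xs]≤f[argmax] {f = length} [] (tabulate c)) (∈-tabulate⁺ i)

  newest : Subset n
  newest = Vec.tabulate λ i → does (c i ≟ longest)

  -- W is the block updated last and h the history before that update; the
  -- initial configuration counts as the result of updating all cells.
  record Trace (W : Subset n) (h : History n) : Set where
    field
      nonempty : Nonempty W
      updated  : ∀ {i} → i ∈ W → c i ≡ h
      outdated : ∀ {i} → i ∉ W → length (c i) < length h

  module _ {W h} (t : Trace W h) where
    open Trace t

    length-h≤longest : length h ≤ length longest
    length-h≤longest with nonempty
    ... | i , i∈W = subst (λ g → length g ≤ length longest) (updated i∈W)
      (length≤longest i)

    -- Since `W` is nonempty, some cell holds `h`; the cells outside `W` hold strictly shorter lists
    -- and cannot attain the maximum.
    longest≡ : longest ≡ h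
    longest≡ with argmax-sel length [] (tabulate c)
    -- If `argmax` returns its default `[]`, then `h` is no longer than `[]`, so the two coincide.
    ... | inj₁ eq = trans eq (sym (empty h
            (subst (λ g → length h ≤ length g) eq length-h≤longest)))
      where
      empty : ∀ (g : History n) → length g ≤ 0 → g ≡ []
      empty [] _ = refl
    ... | inj₂ l∈c with ∈-tabulate⁻ l∈c
    ...   | i , eq with i ∈? W
    ...     | yes i∈W = trans eq (updated i∈W)
    ...     | no  i∉W = contradiction (outdated i∉W)
                (≤⇒≯ (subst (λ g → length h ≤ length g) eq length-h≤longest))

    -- A cell outside `W` holds a list too short to be `h`, so comparison with `longest` decides
    -- membership in `W`.
    newest≡ : newest ≡ W
    newest≡ = trans (Vecₚ.tabulate-cong pointwise) (Vecₚ.tabulate∘lookup W)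
      where
      pointwise : ∀ i → does (c i ≟ longest) ≡ Vec.lookup W i
      pointwise i with i ∈? W
      ... | yes i∈W = trans (dec-true (c i ≟ longest) (trans (updated i∈W) (sym longest≡)))
                            (sym (Vecₚ.[]=⇒lookup i∈W))
      ... | no  i∉W = trans (dec-false (c i ≟ longest) c≢) (sym (∉⇒false i∉W))
        where
        c≢ : c i ≡ longest → _
        c≢ eq = <-irrefl (cong length (trans eq longest≡)) (outdated i∉W)
        ∉⇒false : i ∉ W → Vec.lookup W i ≡ false
        ∉⇒false i∉W with Vec.lookup W i in eq
        ... | false = refl
        ... | true  = contradiction (Vecₚ.lookup⇒[]= i W eq) i∉W

  history : History n
  history = newest ∷ longest

  history≡ : ∀ {W h} → Trace W h → history ≡ W ∷ h
  history≡ t = cong₂ _∷_ (newest≡ t) (longest≡ t)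

-- The histories stored in cells while the blocks are applied. The final one is only read off the
-- last configuration, never stored, so it is left out.
written : ∀ {n} → History n → List (Subset n) → List (History n)
written h []       = []
written h (W ∷ Ws) = h ∷ written (W ∷ h) Ws

module Recorder {n} (hs : List (History n)) where
  open DecMembership (_≟_ {n}) using () renaming (_∈?_ to _∈ˡ?_)

  Letter : Set
  Letter = Fin (suc (length hs))

  -- Prepending `[]` makes `zero` the letter for the empty list, which every cell holds initially.
  decode : Letter → History n
  decode = lookup ([] ∷ hs)

  -- Histories outside hs are sent to the junk value zero.
  encode : History n → Letter
  encode h with h ∈ˡ? hs
  ... | yes h∈hs = suc (index h∈hs)
  ... | no  _    = zero

  decode-encode : ∀ {h} → h ∈ˡ hs → decode (encode h) ≡ h
  decode-encode {h} h∈hs with h ∈ˡ? hs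
  ... | yes p = sym (lookup-index p)
  ... | no  h∉hs = contradiction h∈hs h∉hs

  X : Fin n → Set
  X _ = Letter

  X-alphabet : ∀ i → IsAlphabet (X i)
  X-alphabet i = (suc (length hs) , ↔-id _) , zero

  cells : Config X → Fin n → History n
  cells x i = decode (component x i)

  recorder : Network X
  recorder x = config λ _ → encode (history (cells x))

  initial : Config X
  initial = config λ _ → zero

  initial-trace : Nonempty (⊤ {n}) → Trace (cells initial) ⊤ []
  initial-trace ne = record
    { nonempty = ne
    ; updated  = λ {i} _ → cong decode (component-config {X = X} (λ _ → zero) i)
    ; outdated = λ i∉⊤ → contradiction ∈⊤ i∉⊤
    }

  -- The cells of `W` receive `V ∷ h`, which `encode` preserves because it lies in `hs`. All others
  -- keep lists no longer than `h`, the previous maximum, and so become outdated.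
  updateBlock-trace : ∀ {x V W h} → Nonempty W → V ∷ h ∈ˡ hs →
                      Trace (cells x) V h →
                      Trace (cells (updateBlock recorder W x)) W (V ∷ h)
  updateBlock-trace {x} {V} {W} {h} ne Vh∈hs t = record
    { nonempty = ne
    ; updated  = λ {i} i∈W → trans
        (cong decode (trans (updateBlock-∈ recorder x i∈W)
          (trans (component-config {X = X} (λ _ → encode (history (cells x))) i)
                 (cong encode (history≡ _ t)))))
        (decode-encode Vh∈hs)
    ; outdated = λ {i} i∉W → subst (λ a → length (decode a) < suc (length h))
        (sym (updateBlock-∉ recorder x i∉W)) (≤-<-trans (short i) (n<1+n _))
    }
    where
    short : ∀ i → length (cells x i) ≤ length h
    short i = subst (λ g → length (cells x i) ≤ length g) (longest≡ _ t)
      (length≤longest (cells x) i)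

  -- Induction on the blocks still to come; `g` is general because `foldl` accumulates there the
  -- updates already made.
  run-history : ∀ {V h} Ws (g : Config X → Config X) {x} →
                All Nonempty Ws → written (V ∷ h) Ws ⊆ hs →
                Trace (cells (g x)) V h →
                history (cells (foldl (λ g W → updateBlock recorder W ∘ g) g Ws x))
                  ≡ Ws ʳ++ (V ∷ h)
  run-history []       g []         _   t = history≡ _ t
  run-history (W ∷ Ws) g (ne ∷ nes) sub t =
    run-history Ws (updateBlock recorder W ∘ g) nes (sub ∘ there)
      (updateBlock-trace ne (sub (here refl)) t)

lemma2 : (n : ℕ) → n ≥ 1 → (μ μ′ : BP n) →
    (μ ≡₀ μ′) ⇔
    ((X : Fin n → Set) → (∀ i → IsAlphabet (X i)) →
    (f : Network X) → update f μ ≗ update f μ′)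
lemma2 (suc n) _ μ μ′ = mk⇔
  (λ eq X _ f x → cong (λ Ws → foldl (λ g W → updateBlock {X = X} f W ∘ g) id Ws x) eq)
  (λ same → ʳ++-injectiveˡ [ ⊤ ]
    (trans (sym (recorded μ (xs⊆xs++ys _ _)))
    (trans (cong (history ∘ cells) (same X X-alphabet recorder initial))
           (recorded μ′ (xs⊆ys++xs _ _)))))
  where
  -- A single network has to distinguish the two modes, so its alphabet must contain the histories
  -- of both runs.
  open Recorder (written [ ⊤ ] (φ μ) ++ written [ ⊤ ] (φ μ′))

  recorded : ∀ ν → written [ ⊤ ] (φ ν) ⊆ written [ ⊤ ] (φ μ) ++ written [ ⊤ ] (φ μ′) →
             history (cells (update {X = X} recorder ν initial)) ≡ φ ν ʳ++ [ ⊤ ]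
  recorded ν sub =
    run-history (φ ν) id (φ-nonempty ν) sub (initial-trace (zero , ∈⊤))
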